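{- Let $H$ be a polyomino graph with a perfect matching, and let $K$ be a maximal alternating set of $H$. Then $H-K$ has a unique perfect matching.
   Context: A polyomino graph is a connected finite subgraph of the infinite plane square grid such that each interior (finite) face is bounded by a unit square and each edge belongs to at least one such square. For a perfect matching $M$, a cycle is $M$-alternating if its edges alternate between edges in $M$ and edges not in $M$; a finite face is $M$-resonant if its boundary is $M$-alternating. A set of finite faces (not necessarily disjoint) is an alternating set if there is a perfect matching $M$ of $H$ such that all its faces are $M$-resonant; it is maximal if it is not properly contained in another alternating set of $H$. $H-K$ denotes the graph obtained by deleting all vertices lying on boundaries of faces in $K$ (the empty graph has exactly one perfect matching). -}

module Defs where

open import Data.Integer using (ℤ; _+_; _<_; 1ℤ)
open import Data.Product using (Σ; ∃; _×_; _,_; proj₁; proj₂)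
open import Data.Sum using (_⊎_)
open import Data.List using (List)
open import Data.List.Membership.Propositional using (_∈_)
open import Data.List.Relation.Unary.All using (All)
open import Relation.Nullary using (¬_)
open import Relation.Binary.PropositionalEquality using (_≡_)
open import Level using (0ℓ)

Point : Set
Point = ℤ × ℤ

data Edge : Set where
  hor : ℤ → ℤ → Edge
  ver : ℤ → ℤ → Edge

end₁ : Edge → Point
end₁ (hor x y) = (x , y)
end₁ (ver x y) = (x , y)

end₂ : Edge → Point
end₂ (hor x y) = (x + 1ℤ , y)
end₂ (ver x y) = (x , y + 1ℤ)

Inc : Point → Edge → Set
Inc u e = (u ≡ end₁ e) ⊎ (u ≡ end₂ e)

-- Unit squares (cells) of the grid; cell (x , y) has corners
-- (x,y), (x+1,y), (x+1,y+1), (x,y+1).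
Cell : Set
Cell = ℤ × ℤ

bottom right top left : Cell → Edge
bottom (x , y) = hor x y
right  (x , y) = ver (x + 1ℤ) y
top    (x , y) = hor x (y + 1ℤ)
left   (x , y) = ver x y

SideOf : Edge → Cell → Set
SideOf e c = (e ≡ bottom c) ⊎ (e ≡ right c) ⊎ (e ≡ top c) ⊎ (e ≡ left c)

CornerOf : Point → Cell → Set
CornerOf u (x , y) =
  (u ≡ (x , y)) ⊎ (u ≡ (x + 1ℤ , y)) ⊎ (u ≡ (x + 1ℤ , y + 1ℤ)) ⊎ (u ≡ (x , y + 1ℤ))

IsPerfectMatching : (Point → Set) → (Edge → Set) → (Edge → Set) → Set
IsPerfectMatching V E M =
  (∀ e → M e → E e) ×
  (∀ u → V u → ∃ λ e → M e × Inc u e) ×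
  (∀ u e e′ → M e → M e′ → Inc u e → Inc u e′ → e ≡ e′)

HasUniquePerfectMatching : (Point → Set) → (Edge → Set) → Set₁
HasUniquePerfectMatching V E =
  Σ (Edge → Set) λ M → IsPerfectMatching V E M ×
    (∀ M′ → IsPerfectMatching V E M′ → ∀ e → (M e → M′ e) × (M′ e → M e))

-- A finite grid subgraph H given by its (finite) list of edges;
-- its vertices are the endpoints of its edges.

VertexOf : List Edge → Point → Set
VertexOf H u = ∃ λ e → e ∈ H × Inc u e

EdgeOf : List Edge → Edge → Set
EdgeOf H e = e ∈ H

data Reach (H : List Edge) (u : Point) : Point → Set where
  here : Reach H u u
  step : ∀ {w e v} → Reach H u w → e ∈ H → Inc w e → Inc v e → Reach H u v

Connected : List Edge → Set
Connected H = ∀ u v → VertexOf H u → VertexOf H v → Reach H u v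

-- A cell all of whose four sides are edges of H.  Its interior is then a
-- finite face of (the plane embedding of) H bounded by a unit square.
IsSquareFace : List Edge → Cell → Set
IsSquareFace H c = bottom c ∈ H × right c ∈ H × top c ∈ H × left c ∈ H

-- Two cells are in the same face of H iff one can get from one to the
-- other by crossing sides which are not edges of H.
data DualReach (H : List Edge) (c : Cell) : Cell → Set where
  here : DualReach H c c
  step : ∀ {d d′ e} → DualReach H c d → SideOf e d → SideOf e d′ →
         ¬ (e ∈ H) → DualReach H c d′

-- A cell lying strictly to the right of every vertex of H; such a cell is
-- inside the unbounded (infinite) face of H.
FarRight : List Edge → Cell → Set
FarRight H d = ∀ u → VertexOf H u → proj₁ u < proj₁ d

-- Every finite face is bounded by a unit square: every cell which is not
-- itself a square face of H lies in the unbounded face.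
FiniteFacesAreSquares : List Edge → Set
FiniteFacesAreSquares H =
  ∀ c → ¬ IsSquareFace H c → ∃ λ d → DualReach H c d × FarRight H d

EdgesInSquares : List Edge → Set
EdgesInSquares H = ∀ e → e ∈ H → ∃ λ c → SideOf e c × IsSquareFace H c

IsPolyomino : List Edge → Set
IsPolyomino H = Connected H × FiniteFacesAreSquares H × EdgesInSquares H

Resonant : (Edge → Set) → Cell → Set
Resonant M c =
  (M (bottom c) × ¬ M (right c) × M (top c) × ¬ M (left c)) ⊎
  (¬ M (bottom c) × M (right c) × ¬ M (top c) × M (left c))

HasPerfectMatching : List Edge → Set₁
HasPerfectMatching H = Σ (Edge → Set) λ M → IsPerfectMatching (VertexOf H) (EdgeOf H) M

IsAlternatingSet : List Edge → List Cell → Set₁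
IsAlternatingSet H K =
  All (IsSquareFace H) K ×
  Σ (Edge → Set) λ M → IsPerfectMatching (VertexOf H) (EdgeOf H) M ×
    (∀ c → c ∈ K → Resonant M c)

_⊆ᶜ_ : List Cell → List Cell → Set
K ⊆ᶜ K′ = ∀ c → c ∈ K → c ∈ K′

IsMaximalAlternatingSet : List Edge → List Cell → Set₁
IsMaximalAlternatingSet H K =
  IsAlternatingSet H K ×
  (∀ K′ → IsAlternatingSet H K′ → K ⊆ᶜ K′ → K′ ⊆ᶜ K)

OnK : List Cell → Point → Set
OnK K u = ∃ λ c → c ∈ K × CornerOf u c

VertexMinus : List Edge → List Cell → Point → Set
VertexMinus H K u = VertexOf H u × ¬ OnK K u

EdgeMinus : List Edge → List Cell → Edge → Set
EdgeMinus H K e = e ∈ H × ¬ OnK K (end₁ e) × ¬ OnK K (end₂ e)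

{-# OPTIONS --safe #-}
module Submission where

open import Defs
open import Data.Bool using (Bool; true; false; not; _xor_)
open import Data.Bool.Properties using (not-involutive; not-distribˡ-xor; not-distribʳ-xor; ¬-not)
  renaming (_≟_ to _≟ᵇ_)
open import Data.Empty using (⊥; ⊥-elim)
open import Data.Integer using (ℤ; +_; -[1+_]; _+_; -_; _-_; _≤_; _<_; 0ℤ; 1ℤ; -1ℤ; _⊔_; +≤+; -≤+; +<+)
import Data.Integer.Properties as ℤₚ
open import Data.Integer.Solver using (module +-*-Solver)
open import Data.List using (List; []; _∷_; map; filter)
open import Data.List.Extrema ℤₚ.≤-totalOrder using (argmin; argmin-all; f[argmin]≤f[xs])
import Data.List.Membership.DecPropositional as DecMembership
open import Data.List.Membership.Propositional using (_∈_; find; lose)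
open import Data.List.Membership.Propositional.Properties using (∈-filter⁺; ∈-map⁺)
open import Data.List.Relation.Unary.All using (_∷_; lookup)
open import Data.List.Relation.Unary.All.Properties using (all-filter)
open import Data.List.Relation.Unary.Any using (any?; here; there)
open import Data.Nat as ℕ using (ℕ; zero; suc)
open import Data.Product using (∃; _×_; _,_; proj₁; proj₂)
open import Data.Product.Properties using (≡-dec)
open import Data.Sum using (_⊎_; inj₁; inj₂; swap)
open import Function using (_∘_; case_of_)
open import Level using (0ℓ)
open import Relation.Binary.Definitions using (DecidableEquality)
open import Relation.Binary.PropositionalEquality
open import Relation.Nullary using (¬_; Dec; yes; no; does)
open import Relation.Nullary.Decidable using (_×-dec_; _⊎-dec_; dec-true; map′)
open import Relation.Unary using (Pred; Decidable)

-- The matching M for which K is resonant pairs the vertices on K among themselves, so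
-- perfect matchings of H − K extend by M to perfect matchings of H for which K is still
-- resonant.  For two such extensions consider the integer height difference on the cells
-- of the plane, which changes by ±1 across an edge lying in exactly one of them and
-- vanishes outside the faces of H.  If they differ, then up to exchanging them its maximum
-- m is positive; let S be the finite region of height m.  If two opposite sides of a cell
-- of S are each used by one of the matchings, the cell is resonant for one of them; by
-- maximality it is then in K, so the matchings agree at its corners.  Hence no cell of S
-- with a corner at which the matchings differ has such a pair of sides.  Starting from the
-- leftmost cell of the top row of S, this forces the leftmost cell of every next row to
-- exist and to lie further left, so S would be infinite.

-- Integer coordinates

+1-injective : ∀ {i j} → i + 1ℤ ≡ j + 1ℤ → i ≡ j
+1-injective {i} {j} eq = begin
  i               ≡⟨ lem i ⟩
  (i + 1ℤ) + -1ℤ  ≡⟨ cong (_+ -1ℤ) eq ⟩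
  (j + 1ℤ) + -1ℤ  ≡⟨ lem j ⟨
  j               ∎
  where
  open ≡-Reasoning
  lem : ∀ i → i ≡ (i + 1ℤ) + -1ℤ
  lem = solve 1 (λ i → i := (i :+ con 1ℤ) :+ con -1ℤ) refl
    where open +-*-Solver

predecessor : ∀ i → ∃ λ j → i ≡ j + 1ℤ
predecessor i = i + -1ℤ , solve 1 (λ i → i := (i :+ con -1ℤ) :+ con 1ℤ) refl i
  where open +-*-Solver

i<i+1 : ∀ i → i < i + 1ℤ
i<i+1 i = subst (_< i + 1ℤ) (ℤₚ.+-identityʳ i) (ℤₚ.+-monoʳ-< i (+<+ (ℕ.s≤s ℕ.z≤n)))

i+1≢i : ∀ {i} → i + 1ℤ ≢ i
i+1≢i {i} eq = ℤₚ.<-irrefl (sym eq) (i<i+1 i)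

i<j⇒i+1≤j : ∀ {i j} → i < j → i + 1ℤ ≤ j
i<j⇒i+1≤j {i} i<j = subst (_≤ _) (ℤₚ.+-comm 1ℤ i) (ℤₚ.i<j⇒suc[i]≤j i<j)

i+j≤i⇒j≤0 : ∀ {i j} → i + j ≤ i → j ≤ 0ℤ
i+j≤i⇒j≤0 {i} {j} le =
  subst₂ _≤_ (solve 2 (λ i j → :- i :+ (i :+ j) := j) refl i j) (ℤₚ.+-inverseˡ i)
    (ℤₚ.+-monoʳ-≤ (- i) le)
  where open +-*-Solver

i+j≡i⇒j≡0 : ∀ {i j} → i + j ≡ i → j ≡ 0ℤ
i+j≡i⇒j≡0 {i} {j} eq =
  trans (solve 2 (λ i j → j := :- i :+ (i :+ j)) refl i j)
    (trans (cong (λ k → - i + k) eq) (ℤₚ.+-inverseˡ i))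
  where open +-*-Solver

odd : ℤ → Bool
odd (+ zero)        = false
odd (+ suc n)       = not (odd (+ n))
odd -[1+ zero ]     = true
odd -[1+ suc n ]    = not (odd -[1+ n ])

odd-+1 : ∀ i → odd (i + 1ℤ) ≡ not (odd i)
odd-+1 (+ n)            = cong (odd ∘ +_) (lem n)
  where
  lem : ∀ n → n ℕ.+ 1 ≡ suc n
  lem zero    = refl
  lem (suc n) = cong suc (lem n)
odd-+1 -[1+ zero ]      = refl
odd-+1 -[1+ suc n ]     = sym (not-involutive _)

-- The checkerboard colouring. Cells sharing a side differ in it, so it can carry the sign of a
-- height change.
colour : Cell → Bool
colour (x , y) = odd x xor odd y

colour-right : ∀ x y → colour (x + 1ℤ , y) ≡ not (colour (x , y))
colour-right x y rewrite odd-+1 x = sym (not-distribˡ-xor (odd x) (odd y))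

colour-up : ∀ x y → colour (x , y + 1ℤ) ≡ not (colour (x , y))
colour-up x y rewrite odd-+1 y = sym (not-distribʳ-xor (odd x) (odd y))

-- Decidability and finiteness

_≟ᵖ_ : DecidableEquality Point
_≟ᵖ_ = ≡-dec ℤₚ._≟_ ℤₚ._≟_

_≟ᵉ_ : DecidableEquality Edge
hor x y ≟ᵉ hor x′ y′ = map′ (λ { refl → refl }) (λ { refl → refl }) ((x , y) ≟ᵖ (x′ , y′))
ver x y ≟ᵉ ver x′ y′ = map′ (λ { refl → refl }) (λ { refl → refl }) ((x , y) ≟ᵖ (x′ , y′))
hor _ _ ≟ᵉ ver _ _ = no λ ()
ver _ _ ≟ᵉ hor _ _ = no λ ()

open DecMembership _≟ᵉ_ using () renaming (_∈?_ to _∈ᵉ?_)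

isSquareFace? : ∀ H → Decidable (IsSquareFace H)
isSquareFace? H c =
  (bottom c ∈ᵉ? H) ×-dec (right c ∈ᵉ? H) ×-dec (top c ∈ᵉ? H) ×-dec (left c ∈ᵉ? H)

cornerOf? : ∀ u → Decidable (CornerOf u)
cornerOf? u (x , y) = (u ≟ᵖ _) ⊎-dec (u ≟ᵖ _) ⊎-dec (u ≟ᵖ _) ⊎-dec (u ≟ᵖ _)

onK? : ∀ K → Decidable (OnK K)
onK? K u = map′ find (λ (c , c∈K , p) → lose c∈K p) (any? (cornerOf? u) K)

minimiser : {A : Set} {P : Pred A 0ℓ} (f : A → ℤ) → Decidable P → (xs : List A) →
  (∀ {a} → P a → a ∈ xs) → ∀ {a} → P a → ∃ λ m → P m × (∀ {b} → P b → f m ≤ f b)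
minimiser f P? xs P⊆xs {a} Pa =
  -- The default value `a` satisfies `P`, as do all members of `ys`, so the minimiser does too.
  argmin f a ys ,
  argmin-all f Pa (all-filter P? xs) ,
  λ Pb → lookup (f[argmin]≤f[xs] a ys) (∈-filter⁺ P? (P⊆xs Pb) Pb)
  where ys = filter P? xs

⟦_⟧ : (Edge → Bool) → Edge → Set
⟦ n ⟧ e = n e ≡ true

IsPM : List Edge → (Edge → Bool) → Set
IsPM H n = IsPerfectMatching (VertexOf H) (EdgeOf H) ⟦ n ⟧

outside : ∀ {H n} → IsPM H n → ∀ {e} → ¬ e ∈ H → n e ≡ false
outside pm e∉H = ¬-not (e∉H ∘ proj₁ pm _)

-- The height difference of two perfect matchings

ι : Bool → ℤ
ι true  = 1ℤ
ι false = 0ℤ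

jump : Bool → Bool → Bool → ℤ
jump true  i j = ι i - ι j
jump false i j = - (ι i - ι j)

jump-not : ∀ b i j → jump (not b) i j ≡ - jump b i j
jump-not true  i j = refl
jump-not false i j = sym (ℤₚ.neg-involutive _)

jump-swap : ∀ b i j → jump b j i ≡ - jump b i j
jump-swap true  i j = solve 2 (λ i j → j :- i := :- (i :- j)) refl (ι i) (ι j)
  where open +-*-Solver
jump-swap false i j = solve 2 (λ i j → :- (j :- i) := :- (:- (i :- j))) refl (ι i) (ι j)
  where open +-*-Solver

jump-same : ∀ b {i j} → i ≡ j → jump b i j ≡ 0ℤ
jump-same true  {i} refl = ℤₚ.+-inverseʳ (ι i)
jump-same false {i} refl = cong -_ (ℤₚ.+-inverseʳ (ι i))

jump≡0⇒≡ : ∀ b i j → jump b i j ≡ 0ℤ → i ≡ j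
jump≡0⇒≡ b true  true  _ = refl
jump≡0⇒≡ b false false _ = refl
jump≡0⇒≡ true  true  false ()
jump≡0⇒≡ true  false true  ()
jump≡0⇒≡ false true  false ()
jump≡0⇒≡ false false true  ()

jump-true≤0 : ∀ j → jump true true j ≤ 0ℤ → j ≡ true
jump-true≤0 true  _ = refl
jump-true≤0 false (+≤+ ())

jump-false≤0 : ∀ i → jump false i true ≤ 0ℤ → i ≡ true
jump-false≤0 true  _ = refl
jump-false≤0 false (+≤+ ())

-- Each abscissa is raised by 1 because `FarRight` asks for a strict inequality.
bound : List Edge → ℤ
bound []      = 0ℤ
bound (e ∷ H) = (proj₁ (end₁ e) + 1ℤ) ⊔ ((proj₁ (end₂ e) + 1ℤ) ⊔ bound H)

bound-farRight : ∀ H {y} → FarRight H (bound H , y)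
bound-farRight (e ∷ H) u (_ , here refl , inj₁ refl) =
  ℤₚ.<-≤-trans (i<i+1 _) (ℤₚ.i≤i⊔j _ _)
bound-farRight (e ∷ H) u (_ , here refl , inj₂ refl) =
  ℤₚ.<-≤-trans (i<i+1 _)
    (ℤₚ.≤-trans (ℤₚ.i≤i⊔j _ (bound H)) (ℤₚ.i≤j⊔i (proj₁ (end₁ e) + 1ℤ) _))
bound-farRight (e ∷ H) {y} u (e′ , there e′∈H , inc) =
  ℤₚ.<-≤-trans (bound-farRight H {y} u (e′ , e′∈H , inc))
    (ℤₚ.≤-trans (ℤₚ.i≤j⊔i (proj₁ (end₂ e) + 1ℤ) _) (ℤₚ.i≤j⊔i (proj₁ (end₁ e) + 1ℤ) _))

clamp : ℤ → ℕ
clamp (+ n)    = n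
clamp -[1+ n ] = 0

i≤+clamp : ∀ i → i ≤ + clamp i
i≤+clamp (+ n)    = ℤₚ.≤-refl
i≤+clamp -[1+ n ] = -≤+

clamp-≤0 : ∀ {i} → i ≤ 0ℤ → clamp i ≡ 0
clamp-≤0 { + zero }    _ = refl
clamp-≤0 { + suc n }   (+≤+ ())
clamp-≤0 { -[1+ n ] }  _ = refl

-- The recursion is on the number of columns still missing up to `X`.
leftwards-induction : ∀ {ℓ} (X : ℤ) (P : ℤ → Set ℓ) → (∀ x → X ≤ x → P x) →
  (∀ x → P (x + 1ℤ) → P x) → ∀ x → P x
leftwards-induction X P base extend x = go (clamp (X - x)) x
  (subst (_≤ x + + clamp (X - x)) (solve 2 (λ a b → b :+ (a :- b) := a) refl X x)
    (ℤₚ.+-monoʳ-≤ x (i≤+clamp (X - x))))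
  where
  open +-*-Solver
  go : ∀ k x → X ≤ x + + k → P x
  go zero    x le = base x (subst (X ≤_) (ℤₚ.+-identityʳ x) le)
  go (suc k) x le = extend x (go k (x + 1ℤ) (subst (X ≤_) (sym (ℤₚ.+-assoc x 1ℤ (+ k))) le))

module Height (H : List Edge) (n₁ n₂ : Edge → Bool) where

  private X = bound H

  jumpAt : Bool → Edge → ℤ
  jumpAt b e = jump b (n₁ e) (n₂ e)

  -- Signed differences n₁ − n₂ over the vertical edges of row y in the k columns
  -- ending at the bound X, beyond which H has no vertices.
  partialSum : ℤ → ℕ → ℤ
  partialSum y zero    = 0ℤ
  partialSum y (suc k) =
    partialSum y k + jumpAt (colour (X - + k , y)) (ver (X - + k) y)

  opaque
    -- Walking left from beyond `H` to the cell crosses the vertical edges at `X`, ..., `x + 1`,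
    -- each signed by the colour of the cell being left. From column `X` on, clamping makes the sum
    -- empty.
    height : Cell → ℤ
    height (x , y) = partialSum y (clamp (X - x))

    height-unfold : ∀ x y → height (x , y) ≡ partialSum y (clamp (X - x))
    height-unfold x y = refl

-- With this an upper bound proved for both orders of the matchings is also a lower bound.
height-swap : ∀ H n₁ n₂ c → Height.height H n₂ n₁ c ≡ - Height.height H n₁ n₂ c
height-swap H n₁ n₂ (x , y) =
  trans (height-unfold n₂ n₁ x y)
    (trans (go (clamp (bound H - x))) (cong -_ (sym (height-unfold n₁ n₂ x y))))
  where
  open Height H
  go : ∀ k → partialSum n₂ n₁ y k ≡ - partialSum n₁ n₂ y k
  go zero    = refl
  go (suc k) = trans
    (cong₂ _+_ (go k) (jump-swap (colour (bound H - + k , y)) (n₁ e) (n₂ e)))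
    (sym (ℤₚ.neg-distrib-+ (partialSum n₁ n₂ y k) _))
    where e = ver (bound H - + k) y

-- Indexed so that the vertex is (x + 1 , y + 1) and no subtraction occurs.
data AtVertex (x y : ℤ) : Edge → Set where
  east  : AtVertex x y (hor (x + 1ℤ) (y + 1ℤ))
  west  : AtVertex x y (hor x (y + 1ℤ))
  north : AtVertex x y (ver (x + 1ℤ) (y + 1ℤ))
  south : AtVertex x y (ver (x + 1ℤ) y)

inc⇒atVertex : ∀ {x y e} → Inc (x + 1ℤ , y + 1ℤ) e → AtVertex x y e
inc⇒atVertex {e = hor _ _} (inj₁ refl) = east
inc⇒atVertex {e = ver _ _} (inj₁ refl) = north
inc⇒atVertex {x} {y} {hor x′ y′} (inj₂ eq) with +1-injective {x} {x′} (cong proj₁ eq) | cong proj₂ eq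
... | refl | refl = west
inc⇒atVertex {x} {y} {ver x′ y′} (inj₂ eq) with cong proj₁ eq | +1-injective {y} {y′} (cong proj₂ eq)
... | refl | refl = south

atVertex⇒inc : ∀ {x y e} → AtVertex x y e → Inc (x + 1ℤ , y + 1ℤ) e
atVertex⇒inc east  = inj₁ refl
atVertex⇒inc west  = inj₂ refl
atVertex⇒inc north = inj₁ refl
atVertex⇒inc south = inj₂ refl

-- Degrees of a vertex in perfect matchings

degree : (Edge → Bool) → ℤ → ℤ → ℤ
degree n x y = (ι (n (hor (x + 1ℤ) (y + 1ℤ))) + ι (n (hor x (y + 1ℤ)))) +
               (ι (n (ver (x + 1ℤ) (y + 1ℤ))) + ι (n (ver (x + 1ℤ) y)))

Covered : (Edge → Bool) → ℤ → ℤ → Set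
Covered n x y = ∃ λ e → AtVertex x y e × n e ≡ true

covered-or-degree≡0 : ∀ n x y → Covered n x y ⊎ degree n x y ≡ 0ℤ
covered-or-degree≡0 n x y
  with n (hor (x + 1ℤ) (y + 1ℤ)) in e | n (hor x (y + 1ℤ)) in w
     | n (ver (x + 1ℤ) (y + 1ℤ)) in u | n (ver (x + 1ℤ) y) in d
... | true  | _     | _     | _     = inj₁ (_ , east , e)
... | false | true  | _     | _     = inj₁ (_ , west , w)
... | false | false | true  | _     = inj₁ (_ , north , u)
... | false | false | false | true  = inj₁ (_ , south , d)
... | false | false | false | false = inj₂ refl

module _ {H n} (pm : IsPM H n) where

  excluded : ∀ {u e e′} → n e ≡ true → Inc u e → Inc u e′ → e ≢ e′ → n e′ ≢ true
  excluded ne inc inc′ e≢e′ ne′ = e≢e′ (proj₂ (proj₂ pm) _ _ _ ne ne′ inc inc′)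

  covered⇒degree≡1 : ∀ {x y} → Covered n x y → degree n x y ≡ 1ℤ
  covered⇒degree≡1 {x} {y} (_ , at , ne) = by-cases at ne
    where
    other : ∀ {e e′} → AtVertex x y e → n e ≡ true → AtVertex x y e′ → e ≢ e′ → n e′ ≡ false
    other at ne at′ e≢e′ = ¬-not (excluded ne (atVertex⇒inc at) (atVertex⇒inc at′) e≢e′)
    by-cases : ∀ {e} → AtVertex x y e → n e ≡ true → degree n x y ≡ 1ℤ
    by-cases east ne
      rewrite ne | other east ne west (λ eq → i+1≢i (cong (proj₁ ∘ end₁) eq))
                 | other east ne north (λ ()) | other east ne south (λ ()) = refl
    by-cases west ne
      rewrite ne | other west ne east (λ eq → i+1≢i (sym (cong (proj₁ ∘ end₁) eq)))
                 | other west ne north (λ ()) | other west ne south (λ ()) = refl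
    by-cases north ne
      rewrite ne | other north ne south (λ eq → i+1≢i (cong (proj₂ ∘ end₁) eq))
                 | other north ne east (λ ()) | other north ne west (λ ()) = refl
    by-cases south ne
      rewrite ne | other south ne north (λ eq → i+1≢i (sym (cong (proj₂ ∘ end₁) eq)))
                 | other south ne east (λ ()) | other south ne west (λ ()) = refl

-- A covered point is an endpoint of an edge of `H`, hence a vertex that the other matching has to
-- cover.
covered-transfer : ∀ {H n n′ x y} → IsPM H n → IsPM H n′ → Covered n x y → Covered n′ x y
covered-transfer pm pm′ (e , at , ne) =
  let e′ , ne′ , inc = proj₁ (proj₂ pm′) _ (e , proj₁ pm e ne , atVertex⇒inc at)
  in e′ , inc⇒atVertex inc , ne′

-- Both degrees are 1 at the vertices of `H` and 0 elsewhere.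
degree-equal : ∀ {H n n′} → IsPM H n → IsPM H n′ → ∀ x y → degree n x y ≡ degree n′ x y
degree-equal {n = n} {n′} pm pm′ x y
  with covered-or-degree≡0 n x y | covered-or-degree≡0 n′ x y
... | inj₁ cov | _        =
  trans (covered⇒degree≡1 pm cov) (sym (covered⇒degree≡1 pm′ (covered-transfer pm pm′ cov)))
... | inj₂ _   | inj₁ cov =
  trans (covered⇒degree≡1 pm (covered-transfer pm′ pm cov)) (sym (covered⇒degree≡1 pm′ cov))
... | inj₂ eq  | inj₂ eq′ = trans eq (sym eq′)

-- Change of height across the sides of a cell

module HeightLaws (H : List Edge) (n₁ n₂ : Edge → Bool) (pm₁ : IsPM H n₁) (pm₂ : IsPM H n₂) where

  open Height H n₁ n₂ public

  private X = bound H

  jumpAt-outside : ∀ b {e} → ¬ e ∈ H → jumpAt b e ≡ 0ℤ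
  jumpAt-outside b e∉H = jump-same b (trans (outside pm₁ e∉H) (sym (outside pm₂ e∉H)))

  height-beyond : ∀ x y → X ≤ x → height (x , y) ≡ 0ℤ
  height-beyond x y X≤x = trans (height-unfold x y) (cong (partialSum y) (clamp-≤0 (ℤₚ.i≤j⇒i-j≤0 X≤x)))

  farRight-∉ : ∀ {x y u e} → FarRight H (x , y) → Inc u e → x ≤ proj₁ u → ¬ e ∈ H
  farRight-∉ far inc x≤u e∈H = ℤₚ.<⇒≱ (far _ (_ , e∈H , inc)) x≤u

  beyond-∉ : ∀ {x u e} → X ≤ x → Inc u e → x ≤ proj₁ u → ¬ e ∈ H
  beyond-∉ X≤x inc x≤u = farRight-∉ {y = 0ℤ} (bound-farRight H {0ℤ}) inc (ℤₚ.≤-trans X≤x x≤u)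

  private
    beyond : ∀ x y → X - x ≤ 0ℤ →
      0ℤ ≡ height (x + 1ℤ , y) + jumpAt (colour (x + 1ℤ , y)) (ver (x + 1ℤ) y)
    beyond x y le = sym (cong₂ _+_ (height-beyond (x + 1ℤ) y X≤x+1)
      (jumpAt-outside (colour (x + 1ℤ , y)) (beyond-∉ X≤x+1 (inj₁ refl) ℤₚ.≤-refl)))
      where X≤x+1 = ℤₚ.≤-trans (ℤₚ.i-j≤0⇒i≤j le) (ℤₚ.<⇒≤ (i<i+1 x))

  across-left : ∀ x y →
    height (x , y) ≡ height (x + 1ℤ , y) + jumpAt (colour (x + 1ℤ , y)) (ver (x + 1ℤ) y)
  across-left x y with X - x in eq | height-unfold x y
  -- Here the last summand of `partialSum` belongs to the edge at `X - k`, which is `x + 1`. In the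
  -- other two cases both heights vanish and the edge is not in `H`.
  ... | + suc k | unfold = trans unfold
                  (cong₂ (λ h x′ → h + jumpAt (colour (x′ , y)) (ver x′ y))
                    (sym (trans (height-unfold (x + 1ℤ) y)
                      (cong (partialSum y ∘ clamp) (trans (rest X x) (cong (_+ -1ℤ) eq)))))
                    (sym (trans (shift X x) (cong (λ d → X - (d + -1ℤ)) eq))))
    where
    open +-*-Solver
    rest : ∀ a x → a - (x + 1ℤ) ≡ a - x + -1ℤ
    rest = solve 2 (λ a x → a :- (x :+ con 1ℤ) := (a :- x) :+ con -1ℤ) refl
    shift : ∀ a x → x + 1ℤ ≡ a - (a - x + -1ℤ)
    shift = solve 2 (λ a x → x :+ con 1ℤ := a :- ((a :- x) :+ con -1ℤ)) refl
  ... | + zero   | unfold = trans unfold (beyond x y (ℤₚ.≤-reflexive eq))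
  ... | -[1+ n ] | unfold = trans unfold (beyond x y (ℤₚ.≤-trans (ℤₚ.≤-reflexive eq) -≤+))

  -- For `b` the colour of the upper right cell these are the jumps met on one counterclockwise turn
  -- around the vertex: colours and edge directions alternate together, so the signs agree and the
  -- sum is a difference of degrees up to sign.
  jumps-around-vertex : ∀ b x y →
    (jumpAt b (hor (x + 1ℤ) (y + 1ℤ)) + jumpAt b (hor x (y + 1ℤ))) +
    (jumpAt b (ver (x + 1ℤ) (y + 1ℤ)) + jumpAt b (ver (x + 1ℤ) y)) ≡ 0ℤ
  jumps-around-vertex true x y = trans
    (solve 8 (λ e w n s e′ w′ n′ s′ →
      ((e :- e′) :+ (w :- w′)) :+ ((n :- n′) :+ (s :- s′)) :=
      ((e :+ w) :+ (n :+ s)) :- ((e′ :+ w′) :+ (n′ :+ s′))) refl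
      (at n₁ E) (at n₁ W) (at n₁ N) (at n₁ S) (at n₂ E) (at n₂ W) (at n₂ N) (at n₂ S))
    (ℤₚ.i≡j⇒i-j≡0 (degree-equal pm₁ pm₂ x y))
    where
    open +-*-Solver
    at : (Edge → Bool) → Edge → ℤ
    at n e = ι (n e)
    E = hor (x + 1ℤ) (y + 1ℤ)
    W = hor x (y + 1ℤ)
    N = ver (x + 1ℤ) (y + 1ℤ)
    S = ver (x + 1ℤ) y
  jumps-around-vertex false x y = trans
    (solve 4 (λ e w n s → (:- e :+ :- w) :+ (:- n :+ :- s) := :- ((e :+ w) :+ (n :+ s)))
      refl
      (jumpAt true (hor (x + 1ℤ) (y + 1ℤ))) (jumpAt true (hor x (y + 1ℤ)))
      (jumpAt true (ver (x + 1ℤ) (y + 1ℤ))) (jumpAt true (ver (x + 1ℤ) y)))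
    (cong -_ (jumps-around-vertex true x y))
    where open +-*-Solver

  jumpAt-flip : ∀ {b b′} e → b′ ≡ not b → jumpAt b e ≡ - jumpAt b′ e
  jumpAt-flip {b} e refl = trans (sym (ℤₚ.neg-involutive _)) (cong -_ (sym (jump-not b (n₁ e) (n₂ e))))

  -- Both matchings cover a vertex equally often, so the jumps around it cancel; this
  -- carries the law leftwards from the region beyond H, where all heights are 0.
  across-bottom′ : ∀ x y →
    height (x , y + 1ℤ) ≡ height (x , y) + jumpAt (colour (x , y + 1ℤ)) (hor x (y + 1ℤ))
  across-bottom′ x y = leftwards-induction X
    (λ x → height (x , y + 1ℤ) ≡ height (x , y) + jumpAt (colour (x , y + 1ℤ)) (hor x (y + 1ℤ)))
    (λ x X≤x → trans (height-beyond x (y + 1ℤ) X≤x)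
      (sym (cong₂ _+_ (height-beyond x y X≤x)
        (jumpAt-outside (colour (x , y + 1ℤ)) (beyond-∉ X≤x (inj₁ refl) ℤₚ.≤-refl)))))
    extend x
    where
    open ≡-Reasoning
    extend : ∀ x →
      height (x + 1ℤ , y + 1ℤ) ≡
        height (x + 1ℤ , y) + jumpAt (colour (x + 1ℤ , y + 1ℤ)) (hor (x + 1ℤ) (y + 1ℤ)) →
      height (x , y + 1ℤ) ≡ height (x , y) + jumpAt (colour (x , y + 1ℤ)) (hor x (y + 1ℤ))
    extend x ih = begin
      height (x , y + 1ℤ)
        ≡⟨ across-left x (y + 1ℤ) ⟩
      height (x + 1ℤ , y + 1ℤ) + n
        ≡⟨ cong (_+ n) ih ⟩
      (height (x + 1ℤ , y) + e) + n
        ≡⟨ rearrange (height (x + 1ℤ , y)) e n w s ⟩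
      ((height (x + 1ℤ , y) + - s) + - w) + ((e + w) + (n + s))
        ≡⟨ cong (λ k → ((height (x + 1ℤ , y) + - s) + - w) + k) (jumps-around-vertex b x y) ⟩
      ((height (x + 1ℤ , y) + - s) + - w) + 0ℤ
        ≡⟨ ℤₚ.+-identityʳ _ ⟩
      (height (x + 1ℤ , y) + - s) + - w
        ≡⟨ cong₂ (λ i j → (height (x + 1ℤ , y) + i) + j)
             (jumpAt-flip (ver (x + 1ℤ) y) (colour-up (x + 1ℤ) y))
             (jumpAt-flip (hor x (y + 1ℤ)) (colour-right x (y + 1ℤ))) ⟨
      (height (x + 1ℤ , y) + jumpAt (colour (x + 1ℤ , y)) (ver (x + 1ℤ) y)) + west′
        ≡⟨ cong (_+ west′) (across-left x y) ⟨
      height (x , y) + west′ ∎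
      where
      b = colour (x + 1ℤ , y + 1ℤ)
      e = jumpAt b (hor (x + 1ℤ) (y + 1ℤ))
      w = jumpAt b (hor x (y + 1ℤ))
      n = jumpAt b (ver (x + 1ℤ) (y + 1ℤ))
      s = jumpAt b (ver (x + 1ℤ) y)
      west′ = jumpAt (colour (x , y + 1ℤ)) (hor x (y + 1ℤ))
      rearrange : ∀ a e n w s → (a + e) + n ≡ ((a + - s) + - w) + ((e + w) + (n + s))
      rearrange = solve 5 (λ a e n w s →
        (a :+ e) :+ n := ((a :+ :- s) :+ :- w) :+ ((e :+ w) :+ (n :+ s))) refl
        where open +-*-Solver

  private
    reverse : ∀ {i j k l} → i ≡ j + k → l ≡ - k → j ≡ i + l
    reverse {j = j} {k} refl refl = solve 2 (λ j k → j := (j :+ k) :+ :- k) refl j k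
      where open +-*-Solver

  -- Crossing back negates the jump, which the opposite colour of the neighbour absorbs. Hence all
  -- four laws take their sign from the cell being left, with the colour negated for horizontal
  -- sides.
  across-right : ∀ x y →
    height (x + 1ℤ , y) ≡ height (x , y) + jumpAt (colour (x , y)) (ver (x + 1ℤ) y)
  across-right x y =
    reverse (across-left x y) (jumpAt-flip (ver (x + 1ℤ) y) (colour-right x y))

  across-bottom : ∀ x y →
    height (x , y) ≡ height (x , y + 1ℤ) + jumpAt (not (colour (x , y + 1ℤ))) (hor x (y + 1ℤ))
  across-bottom x y = reverse (across-bottom′ x y)
    (jump-not (colour (x , y + 1ℤ)) (n₁ (hor x (y + 1ℤ))) (n₂ (hor x (y + 1ℤ))))

  across-top : ∀ x y →
    height (x , y + 1ℤ) ≡ height (x , y) + jumpAt (not (colour (x , y))) (hor x (y + 1ℤ))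
  across-top x y = trans (across-bottom′ x y)
    (cong (λ b → height (x , y) + jumpAt b (hor x (y + 1ℤ))) (colour-up x y))

  across-outside : ∀ {i j} b {e} → i ≡ j + jumpAt b e → ¬ e ∈ H → i ≡ j
  across-outside {j = j} b eq e∉H =
    trans eq (trans (cong (λ k → j + k) (jumpAt-outside b e∉H)) (ℤₚ.+-identityʳ j))

  -- The height on the upper or right side of the edge. Comparing both cells of a `DualReach` step
  -- with it avoids a case split on pairs of sides.
  edgeHeight : Edge → ℤ
  edgeHeight (hor x y) = height (x , y)
  edgeHeight (ver x y) = height (x , y)

  height-side : ∀ {e} c → SideOf e c → ¬ e ∈ H → height c ≡ edgeHeight e
  height-side c       (inj₁ refl)               e∉H = refl
  height-side (x , y) (inj₂ (inj₁ refl))        e∉H =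
    across-outside (colour (x + 1ℤ , y)) (across-left x y) e∉H
  height-side (x , y) (inj₂ (inj₂ (inj₁ refl))) e∉H =
    across-outside (not (colour (x , y + 1ℤ))) (across-bottom x y) e∉H
  height-side c       (inj₂ (inj₂ (inj₂ refl))) e∉H = refl

  height-dualReach : ∀ {c d} → DualReach H c d → height c ≡ height d
  height-dualReach here = refl
  height-dualReach (step {d} {d′} reach side side′ e∉H) =
    trans (height-dualReach reach)
      (trans (height-side d side e∉H) (sym (height-side d′ side′ e∉H)))

  -- Since `X` is at least 0, a far right cell may still lie left of `X`; the edges in between are
  -- not in `H`, so height 0 spreads leftwards.
  height-farRight : ∀ x y → FarRight H (x , y) → height (x , y) ≡ 0ℤ
  height-farRight x y = leftwards-induction X
    (λ x → FarRight H (x , y) → height (x , y) ≡ 0ℤ)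
    (λ x X≤x _ → height-beyond x y X≤x)
    (λ x ih far → trans
      (across-outside (colour (x + 1ℤ , y)) (across-left x y)
        (farRight-∉ {x} {y} far (inj₁ refl) (ℤₚ.<⇒≤ (i<i+1 x))))
      (ih λ u v → ℤₚ.<-trans (far u v) (i<i+1 x)))
    x

  -- A cell that is no square face is joined to the unbounded face without crossing `H`, and along
  -- the way the height is constant.
  height≢0⇒face : FiniteFacesAreSquares H → ∀ {c} → height c ≢ 0ℤ → IsSquareFace H c
  height≢0⇒face faces {c} h≢0 with isSquareFace? H c
  ... | yes face = face
  ... | no ¬face =
    let d , reach , far = faces c ¬face
    in ⊥-elim (h≢0 (trans (height-dualReach reach) (height-farRight _ _ far)))

-- A cell is named by its lower left corner, which is the first end of its bottom side.
face⇒listed : ∀ {H c} → IsSquareFace H c → c ∈ map end₁ H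
face⇒listed (b∈H , _) = ∈-map⁺ end₁ b∈H

-- The region of maximal height

module _ {H n} (pm : IsPM H n) (c : Cell) where

  left-right⇒resonant : n (left c) ≡ true → n (right c) ≡ true → Resonant ⟦ n ⟧ c
  left-right⇒resonant nl nr =
    inj₂ (excluded pm nl (inj₁ refl) (inj₁ refl) (λ ()) , nr ,
          excluded pm nl (inj₂ refl) (inj₁ refl) (λ ()) , nl)

  bottom-top⇒resonant : n (bottom c) ≡ true → n (top c) ≡ true → Resonant ⟦ n ⟧ c
  bottom-top⇒resonant nb nt =
    inj₁ (nb , excluded pm nb (inj₂ refl) (inj₁ refl) (λ ()) ,
          nt , excluded pm nb (inj₁ refl) (inj₁ refl) (λ ()))

-- `rigid` is the form in which maximality of the alternating set enters: near a face resonant for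
-- one matching the two agree.
module Comparison (H : List Edge) (faces : FiniteFacesAreSquares H) (n₁ n₂ : Edge → Bool)
  (pm₁ : IsPM H n₁) (pm₂ : IsPM H n₂)
  (rigid : ∀ {n c u e} → n ≡ n₁ ⊎ n ≡ n₂ → IsSquareFace H c → Resonant ⟦ n ⟧ c →
    CornerOf u c → Inc u e → n₁ e ≡ n₂ e)
  where

  open HeightLaws H n₁ n₂ pm₁ pm₂

  -- Indexed to fit `jump`: an edge used by `choice b` alone has jump -1 for the sign `b`.
  choice : Bool → Edge → Bool
  choice true  = n₂
  choice false = n₁

  choice-pm : ∀ b → IsPM H (choice b)
  choice-pm true  = pm₂
  choice-pm false = pm₁

  choice-rigid : ∀ b {c u e} → IsSquareFace H c → Resonant ⟦ choice b ⟧ c →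
    CornerOf u c → Inc u e → n₁ e ≡ n₂ e
  choice-rigid true  = rigid (inj₂ refl)
  choice-rigid false = rigid (inj₁ refl)

  Used Fixed Differ : Edge → Set
  Used e   = ∃ λ b → choice b e ≡ true
  Fixed e  = ∀ b → choice b e ≡ true
  Differ e = n₁ e ≢ n₂ e

  unused⇒≡ : ∀ {e} → ¬ Used e → n₁ e ≡ n₂ e
  unused⇒≡ ¬used = trans (¬-not (¬used ∘ (false ,_))) (sym (¬-not (¬used ∘ (true ,_))))

  differ⇒used : ∀ {e} → Differ e → Used e
  differ⇒used {e} n₁≢n₂ with n₁ e ≟ᵇ true | n₂ e ≟ᵇ true
  ... | yes p | _     = false , p
  ... | no _  | yes q = true , q
  ... | no p  | no q  = ⊥-elim (n₁≢n₂ (trans (¬-not p) (sym (¬-not q))))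

  -- A used edge missing from `choice b` would have jump 1.
  jump≤0⇒choice : ∀ b {e} → jumpAt b e ≤ 0ℤ → Used e → choice b e ≡ true
  jump≤0⇒choice true  le (true  , p) = p
  jump≤0⇒choice false le (false , p) = p
  jump≤0⇒choice true  {e} le (false , p) rewrite p = jump-true≤0 (n₂ e) le
  jump≤0⇒choice false {e} le (true  , p) rewrite p = jump-false≤0 (n₁ e) le

  module Maximum (m : ℤ) (0<m : 0ℤ < m) (height≤m : ∀ c → height c ≤ m) where

    Top : Cell → Set
    Top c = height c ≡ m

    Top? : Decidable Top
    Top? c = height c ℤₚ.≟ m

    top⇒face : ∀ {c} → Top c → IsSquareFace H c
    top⇒face c∈ = height≢0⇒face faces (λ eq → ℤₚ.<-irrefl (trans (sym eq) c∈) 0<m)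

    top⇒listed : ∀ {c} → Top c → c ∈ map end₁ H
    top⇒listed c∈ = face⇒listed (top⇒face c∈)

    outward : ∀ {c d} b {e} → Top c → height d ≡ height c + jumpAt b e → jumpAt b e ≤ 0ℤ
    outward {d = d} b c∈ eq = i+j≤i⇒j≤0 (subst₂ _≤_ eq (sym c∈) (height≤m d))

    stay : ∀ {c d} b {e} → height d ≡ height c + jumpAt b e → n₁ e ≡ n₂ e → Top c → Top d
    stay {c} b eq same c∈ = trans eq
      (trans (cong (λ k → height c + k) (jump-same b same)) (trans (ℤₚ.+-identityʳ _) c∈))

    outward-left : ∀ c → Top c → jumpAt (colour c) (left c) ≤ 0ℤ
    outward-left (x , y) c∈ with predecessor x
    ... | w , refl = outward (colour (w + 1ℤ , y)) c∈ (across-left w y)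

    outward-right : ∀ c → Top c → jumpAt (colour c) (right c) ≤ 0ℤ
    outward-right (x , y) c∈ = outward (colour (x , y)) c∈ (across-right x y)

    outward-bottom : ∀ c → Top c → jumpAt (not (colour c)) (bottom c) ≤ 0ℤ
    outward-bottom (x , y) c∈ with predecessor y
    ... | w , refl = outward (not (colour (x , w + 1ℤ))) c∈ (across-bottom x w)

    outward-top : ∀ c → Top c → jumpAt (not (colour c)) (top c) ≤ 0ℤ
    outward-top (x , y) c∈ = outward (not (colour (x , y))) c∈ (across-top x y)

    -- No neighbour is higher than c, so all used vertical sides of c lie in one and the
    -- same matching, selected by the colour of c (and the horizontal ones in the other).
    not-left-right : ∀ c {u e} → Top c → CornerOf u c → Inc u e → Differ e →
      Used (left c) → ¬ Used (right c)
    not-left-right c c∈ corner inc differ ul ur =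
      differ (choice-rigid b (top⇒face c∈)
        (left-right⇒resonant (choice-pm b) c
          (jump≤0⇒choice b (outward-left c c∈) ul) (jump≤0⇒choice b (outward-right c c∈) ur))
        corner inc)
      where b = colour c

    not-bottom-top : ∀ c {u e} → Top c → CornerOf u c → Inc u e → Differ e →
      Used (top c) → ¬ Used (bottom c)
    not-bottom-top c c∈ corner inc differ ut ub =
      differ (choice-rigid b (top⇒face c∈)
        (bottom-top⇒resonant (choice-pm b) c
          (jump≤0⇒choice b (outward-bottom c c∈) ub) (jump≤0⇒choice b (outward-top c c∈) ut))
        corner inc)
      where b = not (colour c)

    Leftmost : ℤ → ℤ → Set
    Leftmost l y = Top (l , y) × (∀ {x} → Top (x , y) → l ≤ x)

    -- The invariant of the descent through the rows. The last clause covers a row above that starts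
    -- just one column further right: the edge running down from the lower right corner of its first
    -- cell is in both matchings.
    Frontier : ℤ → ℤ → Set
    Frontier l y = Leftmost l y × ¬ Top (l , y + 1ℤ) ×
      (Top (l + 1ℤ , y + 1ℤ) → Fixed (ver (l + 1ℤ + 1ℤ) y))

    leftmost : ∀ {x y} → Top (x , y) → ∃ λ l → Leftmost l y
    leftmost {x} {y} c∈
      with (l , _) , (l∈ , refl) , least ← minimiser proj₁ (λ c → Top? c ×-dec (proj₂ c ℤₚ.≟ y))
             (map end₁ H) (top⇒listed ∘ proj₁) (c∈ , refl)
      = l , l∈ , λ c∈ → least (c∈ , refl)

    -- With c the leftmost cell of its row, its left and top edges lie on the boundary, so
    -- its right and bottom edges are unused; then the bottom-right corner of c can only be
    -- matched downwards, which forces the region to extend to the lower left of c.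
    descend : ∀ l y → Frontier (l + 1ℤ) (y + 1ℤ) → Top (l , y) × Fixed (ver (l + 1ℤ + 1ℤ) y)
    descend l y ((c∈ , least) , above∉ , fixed) =
      stay (colour (l + 1ℤ , y)) (across-left l y) (unused⇒≡ unused-below-left) below∈ , fixed-below
      where
      x x′ y′ : ℤ
      x = l + 1ℤ
      x′ = x + 1ℤ
      y′ = y + 1ℤ

      differ-left : Differ (ver x y′)
      differ-left same = ℤₚ.<⇒≱ (i<i+1 l)
        (least (stay (colour (x , y′)) (across-left l y′) same c∈))

      differ-top : Differ (hor x (y′ + 1ℤ))
      differ-top same = above∉ (stay (not (colour (x , y′))) (across-top x y′) same c∈)

      unused-right : ¬ Used (ver x′ y′)
      unused-right = not-left-right (x , y′) c∈ (inj₁ refl) (inj₁ refl) differ-left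
        (differ⇒used differ-left)

      unused-bottom : ¬ Used (hor x y′)
      unused-bottom = not-bottom-top (x , y′) c∈ (inj₁ refl) (inj₁ refl) differ-left
        (differ⇒used differ-top)

      right∈ : Top (x′ , y′)
      right∈ = stay (colour (x , y′)) (across-right x y′) (unused⇒≡ unused-right) c∈

      below∈ : Top (x , y)
      below∈ = stay (not (colour (x , y′))) (across-bottom x y) (unused⇒≡ unused-bottom) c∈

      unused-bottom-right : ¬ Used (hor x′ y′)
      -- If the upper right cell is in the region, the fixed edge already occupies the right end of
      -- this edge. Otherwise the top side above it lies on the boundary and is used, which rules
      -- out the bottom side.
      unused-bottom-right with Top? (x′ , y′ + 1ℤ)
      ... | yes above∈ = λ (b , p) →
        case proj₂ (proj₂ (choice-pm b)) _ _ _ p (fixed above∈ b) (inj₂ refl) (inj₁ refl) of λ ()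
      ... | no ∉ =
        not-bottom-top (x′ , y′) right∈ (inj₂ (inj₂ (inj₂ refl))) (inj₁ refl) differ
          (differ⇒used differ)
        where
        differ : Differ (hor x′ (y′ + 1ℤ))
        differ same = ∉ (stay (not (colour (x′ , y′))) (across-top x′ y′) same right∈)

      fixed-below : Fixed (ver x′ y)
      fixed-below b
        with proj₁ (proj₂ (choice-pm b)) (x′ , y′)
               (ver x′ y′ , proj₁ (proj₂ (top⇒face c∈)) , inj₁ refl)
      ... | e , p , inc with inc⇒atVertex {x} {y} {e} inc
      ...   | east  = ⊥-elim (unused-bottom-right (b , p))
      ...   | west  = ⊥-elim (unused-bottom (b , p))
      ...   | north = ⊥-elim (unused-right (b , p))
      ...   | south = p

      unused-below-left : ¬ Used (ver x y)
      unused-below-left ul =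
        not-left-right (x , y) below∈ (inj₂ (inj₂ (inj₂ refl))) (inj₁ refl) differ-left ul
          (true , fixed-below true)

    next-frontier : ∀ k y → Frontier (k + 1ℤ) (y + 1ℤ) → ∃ λ l → Frontier l y
    next-frontier k y frontier = l , (l∈ , least) , above∉ , above⇒fixed
      where
      below∈ : Top (k , y)
      below∈ = proj₁ (descend k y frontier)
      l : ℤ
      l = proj₁ (leftmost below∈)
      l∈ : Top (l , y)
      l∈ = proj₁ (proj₂ (leftmost below∈))
      least : ∀ {x} → Top (x , y) → l ≤ x
      least = proj₂ (proj₂ (leftmost below∈))
      l≤k : l ≤ k
      l≤k = least below∈
      above∉ : ¬ Top (l , y + 1ℤ)
      above∉ ∈ = ℤₚ.<⇒≱ (i<i+1 k) (ℤₚ.≤-trans (proj₂ (proj₁ frontier) ∈) l≤k)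
      above⇒fixed : Top (l + 1ℤ , y + 1ℤ) → Fixed (ver (l + 1ℤ + 1ℤ) y)
      -- The hypothesis gives `k + 1 ≤ l + 1`, so `l` equals `k` and the edge is the one fixed by
      -- `descend`.
      above⇒fixed ∈ = subst (λ i → Fixed (ver (i + 1ℤ) y))
        (ℤₚ.≤-antisym (proj₂ (proj₁ frontier) ∈) (ℤₚ.+-monoˡ-≤ 1ℤ l≤k))
        (proj₂ (descend k y frontier))

    -- Every frontier produces one in the row below, so after finitely many rows one would lie under
    -- the lowest row `Y`.
    no-frontier : ∀ {Y} → (∀ {c} → Top c → Y ≤ proj₂ c) → ∀ {l y} → ¬ Frontier l y
    no-frontier {Y} Y≤ {l} {y} = go (clamp (y - Y)) l y
      (subst (_≤ Y + + clamp (y - Y)) (solve 2 (λ a b → b :+ (a :- b) := a) refl y Y)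
        (ℤₚ.+-monoʳ-≤ Y (i≤+clamp (y - Y))))
      where
      open +-*-Solver
      below : ∀ {l y} → Frontier l y → ∃ λ l′ → Frontier l′ (y + -1ℤ)
      below {l} {y} frontier = next-frontier (l + -1ℤ) (y + -1ℤ)
        (subst₂ Frontier (proj₂ (predecessor l)) (proj₂ (predecessor y)) frontier)
      lower : ∀ Y j → Y + (1ℤ + j) + -1ℤ ≡ Y + j
      lower = solve 2 (λ Y j → Y :+ (con 1ℤ :+ j) :+ con -1ℤ := Y :+ j) refl
      go : ∀ k l y → y ≤ Y + + k → ¬ Frontier l y
      go zero l y le frontier =
        ℤₚ.<⇒≱ (ℤₚ.i≤pred[j]⇒i<j (ℤₚ.≤-reflexive (ℤₚ.+-comm y -1ℤ)))
          (ℤₚ.≤-trans (subst (y ≤_) (ℤₚ.+-identityʳ Y) le)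
            (Y≤ (proj₁ (proj₁ (proj₂ (below frontier))))))
      go (suc k) l y le frontier = go k _ (y + -1ℤ)
        (subst (y + -1ℤ ≤_) (lower Y (+ k)) (ℤₚ.+-monoˡ-≤ -1ℤ le)) (proj₂ (below frontier))

    no-top : ∀ {c} → ¬ Top c
    no-top c∈
      with (_ , y) , top∈ , highest ← minimiser (λ c → - proj₂ c) Top? (map end₁ H) top⇒listed c∈
      with (_ , Y) , _ , lowest ← minimiser proj₂ Top? (map end₁ H) top⇒listed c∈
      with l , l-leftmost ← leftmost top∈
      -- Above the highest row the region is empty, so the last clause of `Frontier` is vacuous.
      = no-frontier {Y} lowest (l-leftmost , above∉ , (λ ∈ → ⊥-elim (above∉ ∈)))
      where
      above∉ : ∀ {x} → ¬ Top (x , y + 1ℤ)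
      above∉ ∈ = ℤₚ.<⇒≱ (i<i+1 y) (ℤₚ.neg-cancel-≤ (highest ∈))

  height-nonpositive : ∀ c → ¬ 0ℤ < height c
  height-nonpositive c 0<h
    with (d , 0<m , highest) ← minimiser (λ c → - height c) (λ c → 0ℤ ℤₚ.<? height c) (map end₁ H)
           (λ {c} 0<h → face⇒listed (height≢0⇒face faces {c} (λ eq → ℤₚ.<-irrefl (sym eq) 0<h))) {c} 0<h
    = Maximum.no-top (height d) 0<m height≤m refl
    where
    -- The maximum was taken over the finitely many cells of positive height; all others are below
    -- it anyway.
    height≤m : ∀ c → height c ≤ height d
    height≤m c with 0ℤ ℤₚ.<? height c
    ... | yes 0<h = ℤₚ.neg-cancel-≤ (highest 0<h)
    ... | no 0≮h  = ℤₚ.≤-trans (ℤₚ.≮⇒≥ 0≮h) (ℤₚ.<⇒≤ 0<m)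

-- The height is nonpositive for both orders of the matchings, hence zero everywhere, and then no
-- edge can carry a jump.
perfect-matchings-equal : ∀ H → FiniteFacesAreSquares H → ∀ n₁ n₂ → IsPM H n₁ → IsPM H n₂ →
  (∀ {n c u e} → n ≡ n₁ ⊎ n ≡ n₂ → IsSquareFace H c → Resonant ⟦ n ⟧ c →
    CornerOf u c → Inc u e → n₁ e ≡ n₂ e) →
  ∀ e → n₁ e ≡ n₂ e
perfect-matchings-equal H faces n₁ n₂ pm₁ pm₂ rigid = equal
  where
  open HeightLaws H n₁ n₂ pm₁ pm₂

  height≤0 : ∀ c → height c ≤ 0ℤ
  height≤0 c = ℤₚ.≮⇒≥ (Comparison.height-nonpositive H faces n₁ n₂ pm₁ pm₂ rigid c)

  height≥0 : ∀ c → 0ℤ ≤ height c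
  height≥0 c = ℤₚ.neg-cancel-≤ (subst (_≤ 0ℤ) (height-swap H n₁ n₂ c)
    (ℤₚ.≮⇒≥ (Comparison.height-nonpositive H faces n₂ n₁ pm₂ pm₁
      (λ n∈ face res corner inc → sym (rigid (swap n∈) face res corner inc)) c)))

  height≡0 : ∀ c → height c ≡ 0ℤ
  height≡0 c = ℤₚ.≤-antisym (height≤0 c) (height≥0 c)

  no-jump : ∀ {c d} b e → height c ≡ height d + jumpAt b e → n₁ e ≡ n₂ e
  no-jump {c} {d} b e eq = jump≡0⇒≡ b (n₁ e) (n₂ e)
    (i+j≡i⇒j≡0 {height d} (trans (sym eq) (trans (height≡0 c) (sym (height≡0 d)))))

  equal : ∀ e → n₁ e ≡ n₂ e
  equal (hor x y) with predecessor y
  ... | w , refl = no-jump (colour (x , w + 1ℤ)) (hor x (w + 1ℤ)) (across-bottom′ x w)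
  equal (ver x y) with predecessor x
  ... | w , refl = no-jump (colour (w + 1ℤ , y)) (ver (w + 1ℤ) y) (across-left w y)

-- Extending matchings of H − K by a matching for which K is resonant

_≐_ : (Edge → Set) → (Edge → Set) → Set
N ≐ N′ = ∀ e → (N e → N′ e) × (N′ e → N e)

isPerfectMatching-resp : ∀ {V E N N′} → N ≐ N′ → IsPerfectMatching V E N → IsPerfectMatching V E N′
isPerfectMatching-resp N≐N′ (sub , cover , unique) =
  (λ e p → sub e (proj₂ (N≐N′ e) p)) ,
  (λ u v → let e , p , inc = cover u v in e , proj₁ (N≐N′ e) p , inc) ,
  λ u e e′ p p′ → unique u e e′ (proj₂ (N≐N′ e) p) (proj₂ (N≐N′ e′) p′)

resonant-resp : ∀ {N N′ c} → (∀ {e} → SideOf e c → (N e → N′ e) × (N′ e → N e)) →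
  Resonant N c → Resonant N′ c
resonant-resp {N} {N′} {c} f = by-type
  where
  fb = f {bottom c} (inj₁ refl)
  fr = f {right c} (inj₂ (inj₁ refl))
  ft = f {top c} (inj₂ (inj₂ (inj₁ refl)))
  fl = f {left c} (inj₂ (inj₂ (inj₂ refl)))
  by-type : Resonant N c → Resonant N′ c
  by-type (inj₁ (b , r , t , l)) =
    inj₁ (proj₁ fb b , r ∘ proj₂ fr , proj₁ ft t , l ∘ proj₂ fl)
  by-type (inj₂ (b , r , t , l)) =
    inj₂ (b ∘ proj₂ fb , proj₁ fr r , t ∘ proj₂ ft , proj₁ fl l)

-- To decide an edge of `E`, compare it with the edge that covers its first end. This turns
-- matchings given as predicates into Boolean ones.
matching? : ∀ {V E N} → IsPerfectMatching V E N → Decidable E → (∀ e → E e → V (end₁ e)) →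
  Decidable N
matching? (sub , cover , unique) E? ends e with E? e
... | no ¬Ee = no (¬Ee ∘ sub e)
... | yes Ee with cover (end₁ e) (ends e Ee)
...   | e′ , p′ , inc′ with e ≟ᵉ e′
...     | yes refl = yes p′
...     | no e≢e′  = no λ p → e≢e′ (unique _ e e′ p p′ (inj₁ refl) inc′)

does-true : {P : Set} (d : Dec P) → does d ≡ true → P
does-true (yes p) refl = p

does-cong : {P Q : Set} (p : Dec P) (q : Dec Q) → (P → Q) → (Q → P) → does p ≡ does q
does-cong (yes _) (yes _) _ _ = refl
does-cong (no _)  (no _)  _ _ = refl
does-cong (yes p) (no ¬q) f _ = ⊥-elim (¬q (f p))
does-cong (no ¬p) (yes q) _ g = ⊥-elim (¬p (g q))

side-corner : ∀ {e v} c → SideOf e c → Inc v e → CornerOf v c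
side-corner c (inj₁ refl)               (inj₁ refl) = inj₁ refl
side-corner c (inj₁ refl)               (inj₂ refl) = inj₂ (inj₁ refl)
side-corner c (inj₂ (inj₁ refl))        (inj₁ refl) = inj₂ (inj₁ refl)
side-corner c (inj₂ (inj₁ refl))        (inj₂ refl) = inj₂ (inj₂ (inj₁ refl))
side-corner c (inj₂ (inj₂ (inj₁ refl))) (inj₁ refl) = inj₂ (inj₂ (inj₂ refl))
side-corner c (inj₂ (inj₂ (inj₁ refl))) (inj₂ refl) = inj₂ (inj₂ (inj₁ refl))
side-corner c (inj₂ (inj₂ (inj₂ refl))) (inj₁ refl) = inj₁ refl
side-corner c (inj₂ (inj₂ (inj₂ refl))) (inj₂ refl) = inj₂ (inj₂ (inj₂ refl))

resonant-corner : ∀ {M u} c → Resonant M c → CornerOf u c → ∃ λ e → M e × SideOf e c × Inc u e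
resonant-corner c (inj₁ (b , _ , t , _)) = λ where
  (inj₁ refl)               → bottom c , b , inj₁ refl , inj₁ refl
  (inj₂ (inj₁ refl))        → bottom c , b , inj₁ refl , inj₂ refl
  (inj₂ (inj₂ (inj₁ refl))) → top c , t , inj₂ (inj₂ (inj₁ refl)) , inj₂ refl
  (inj₂ (inj₂ (inj₂ refl))) → top c , t , inj₂ (inj₂ (inj₁ refl)) , inj₁ refl
resonant-corner c (inj₂ (_ , r , _ , l)) = λ where
  (inj₁ refl)               → left c , l , inj₂ (inj₂ (inj₂ refl)) , inj₁ refl
  (inj₂ (inj₁ refl))        → right c , r , inj₂ (inj₁ refl) , inj₁ refl
  (inj₂ (inj₂ (inj₁ refl))) → right c , r , inj₂ (inj₁ refl) , inj₂ refl
  (inj₂ (inj₂ (inj₂ refl))) → left c , l , inj₂ (inj₂ (inj₂ refl)) , inj₂ refl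

module Extension (H : List Edge) (K : List Cell) (M : Edge → Set)
  (pm : IsPerfectMatching (VertexOf H) (EdgeOf H) M) (resonant : ∀ c → c ∈ K → Resonant M c) where

  -- By resonance a vertex on `K` is matched along a side of a cell of `K`, and its `M`-edge is
  -- unique.
  closed : ∀ {u v e} → OnK K u → M e → Inc u e → Inc v e → OnK K v
  closed {u} {v} {e} (c , c∈K , corner) Me inc inc′
    with e′ , Me′ , side , inc″ ← resonant-corner c (resonant c c∈K) corner
    with refl ← proj₂ (proj₂ pm) u e e′ Me Me′ inc inc″
    = c , c∈K , side-corner c side inc′

  minus-∉K : ∀ {u e} → EdgeMinus H K e → Inc u e → ¬ OnK K u
  minus-∉K (_ , end₁∉ , _) (inj₁ refl) = end₁∉
  minus-∉K (_ , _ , end₂∉) (inj₂ refl) = end₂∉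

  restriction : Edge → Set
  restriction e = M e × EdgeMinus H K e

  restriction-pm : IsPerfectMatching (VertexMinus H K) (EdgeMinus H K) restriction
  restriction-pm =
    (λ _ → proj₂) ,
    (λ u (u∈H , u∉K) →
      let e , Me , inc = proj₁ (proj₂ pm) u u∈H in
      e , (Me , proj₁ pm e Me ,
        (λ on → u∉K (closed on Me (inj₁ refl) inc)) ,
        (λ on → u∉K (closed on Me (inj₂ refl) inc))) , inc) ,
    λ u e e′ p p′ → proj₂ (proj₂ pm) u e e′ (proj₁ p) (proj₁ p′)

  module _ (N : Edge → Set) (pmN : IsPerfectMatching (VertexMinus H K) (EdgeMinus H K) N) where

    -- By `closed` an edge of `M` has both ends on `K` or neither, so testing one end suffices.
    extension : Edge → Set
    extension e = N e ⊎ (M e × OnK K (end₁ e))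

    -- Keeps `K` resonant for every extension and makes any two extensions agree at the vertices on
    -- `K`.
    at-K : ∀ {u e} → OnK K u → Inc u e → (M e → extension e) × (extension e → M e)
    at-K on inc =
      (λ Me → inj₂ (Me , closed on Me inc (inj₁ refl))) ,
      λ where
        (inj₁ Ne)       → ⊥-elim (minus-∉K (proj₁ pmN _ Ne) inc on)
        (inj₂ (Me , _)) → Me

    extension-pm : IsPerfectMatching (VertexOf H) (EdgeOf H) extension
    extension-pm = sub , cover , unique
      where
      sub : ∀ e → extension e → e ∈ H
      sub e (inj₁ Ne)       = proj₁ (proj₁ pmN e Ne)
      sub e (inj₂ (Me , _)) = proj₁ pm e Me

      cover : ∀ u → VertexOf H u → ∃ λ e → extension e × Inc u e
      cover u u∈H with onK? K u
      ... | yes on = let e , Me , inc = proj₁ (proj₂ pm) u u∈H in e , proj₁ (at-K on inc) Me , inc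
      ... | no ∉K  = let e , Ne , inc = proj₁ (proj₂ pmN) u (u∈H , ∉K) in e , inj₁ Ne , inc

      disjoint : ∀ {u e e′} → N e → M e′ × OnK K (end₁ e′) → Inc u e → Inc u e′ → ⊥
      disjoint Ne (Me′ , on) inc inc′ =
        minus-∉K (proj₁ pmN _ Ne) inc (closed on Me′ (inj₁ refl) inc′)

      unique : ∀ u e e′ → extension e → extension e′ → Inc u e → Inc u e′ → e ≡ e′
      unique u e e′ (inj₁ p)       (inj₁ p′)       inc inc′ = proj₂ (proj₂ pmN) u e e′ p p′ inc inc′
      unique u e e′ (inj₂ (p , _)) (inj₂ (p′ , _)) inc inc′ = proj₂ (proj₂ pm) u e e′ p p′ inc inc′
      unique u e e′ (inj₁ p)       (inj₂ p′)       inc inc′ = ⊥-elim (disjoint p p′ inc inc′)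
      unique u e e′ (inj₂ p)       (inj₁ p′)       inc inc′ = ⊥-elim (disjoint p′ p inc′ inc)

    extension-resonant : ∀ c → c ∈ K → Resonant extension c
    extension-resonant c c∈K = resonant-resp
      (λ side → at-K (c , c∈K , side-corner c side (inj₁ refl)) (inj₁ refl)) (resonant c c∈K)

    extension? : Decidable extension
    extension? = matching? extension-pm (_∈ᵉ? H) (λ e e∈H → e , e∈H , inj₁ refl)

    indicator : Edge → Bool
    indicator e = does (extension? e)

    extension≐indicator : extension ≐ ⟦ indicator ⟧
    extension≐indicator e = dec-true (extension? e) , does-true (extension? e)

    indicator-pm : IsPM H indicator
    indicator-pm = isPerfectMatching-resp extension≐indicator extension-pm

  module _ (faces : FiniteFacesAreSquares H) (maximal : IsMaximalAlternatingSet H K) where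

    -- The extension makes all faces of `c ∷ K` resonant, so maximality of `K` absorbs `c`.
    resonant⇒∈K : ∀ N pmN {c} → IsSquareFace H c → Resonant ⟦ indicator N pmN ⟧ c → c ∈ K
    resonant⇒∈K N pmN {c} face res = proj₂ maximal (c ∷ K) alternating (λ _ → there) c (here refl)
      where
      alternating : IsAlternatingSet H (c ∷ K)
      alternating = face ∷ proj₁ (proj₁ maximal) , extension N pmN , extension-pm N pmN , λ where
        _ (here refl)  → resonant-resp
          (λ {e} _ → let to , from = extension≐indicator N pmN e in from , to) res
        d (there d∈K) → extension-resonant N pmN d d∈K

    matching-⊆ : ∀ N N′ → IsPerfectMatching (VertexMinus H K) (EdgeMinus H K) N →
      IsPerfectMatching (VertexMinus H K) (EdgeMinus H K) N′ → ∀ e → N e → N′ e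
    matching-⊆ N N′ pmN pmN′ e Ne = restrict (proj₂ (extension≐indicator N′ pmN′ e)
      (trans (sym (perfect-matchings-equal H faces (indicator N pmN) (indicator N′ pmN′)
          (indicator-pm N pmN) (indicator-pm N′ pmN′) rigid e))
        (proj₁ (extension≐indicator N pmN e) (inj₁ Ne))))
      where
      restrict : extension N′ pmN′ e → N′ e
      -- As `e` belongs to `N`, its ends avoid `K`, which leaves only the first alternative.
      restrict (inj₁ N′e)      = N′e
      restrict (inj₂ (_ , on)) = ⊥-elim (minus-∉K (proj₁ pmN e Ne) (inj₁ refl) on)

      agree-at-K : ∀ {u e} → OnK K u → Inc u e → indicator N pmN e ≡ indicator N′ pmN′ e
      agree-at-K {e = e} on inc = does-cong (extension? N pmN e) (extension? N′ pmN′ e)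
        (proj₁ (at-K N′ pmN′ on inc) ∘ proj₂ (at-K N pmN on inc))
        (proj₁ (at-K N pmN on inc) ∘ proj₂ (at-K N′ pmN′ on inc))

      rigid : ∀ {n c u e} → n ≡ indicator N pmN ⊎ n ≡ indicator N′ pmN′ → IsSquareFace H c →
        Resonant ⟦ n ⟧ c → CornerOf u c → Inc u e → indicator N pmN e ≡ indicator N′ pmN′ e
      rigid {c = c} (inj₁ refl) face res corner =
        agree-at-K (c , resonant⇒∈K N pmN face res , corner)
      rigid {c = c} (inj₂ refl) face res corner =
        agree-at-K (c , resonant⇒∈K N′ pmN′ face res , corner)

theorem3p2 : (H : List Edge) → IsPolyomino H → HasPerfectMatching H →
    (K : List Cell) → IsMaximalAlternatingSet H K →
    HasUniquePerfectMatching (VertexMinus H K) (EdgeMinus H K)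
theorem3p2 H (_ , faces , _) _ K maximal@((_ , M , pm , resonant) , _) =
  restriction , restriction-pm , λ N pmN e →
    matching-⊆ faces maximal restriction N restriction-pm pmN e ,
    matching-⊆ faces maximal N restriction pmN restriction-pm e
  where open Extension H K M pm resonant
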